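{- If $T$ is a subcubic tree of order $n$, then $\frac{2n}{3}\le \psi(T)\le \frac{4n+2}{5}$. Moreover, both bounds are tight, i.e., each bound is attained with equality by some subcubic trees.
   Context: All graphs are finite, simple and undirected. A subcubic tree is a tree of maximum degree at most $3$. A dissociation set in a graph $G$ is a vertex subset $F$ such that the induced subgraph $G[F]$ has maximum degree at most $1$; the dissociation number $\psi(G)$ is the maximum cardinality of a dissociation set of $G$. -}

module Defs where

open import Data.Bool.Base using (true; false)
open import Data.Fin.Base using (Fin; zero; suc)
open import Data.Fin.Properties using (all?; suc-injective)
open import Data.Fin.Subset using (Subset; inside; outside; ∣_∣; _∈_; ⊥)
open import Data.Fin.Subset.Properties using (∣⊥∣≡0)
open import Data.List.Base using (List; []; _∷_; _++_; _∷ʳ_; map; filter; length)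
open import Data.List.Extrema.Nat using (max; xs≤max; argmax-sel)
open import Data.List.Membership.Propositional using () renaming (_∈_ to _∈ˡ_)
open import Data.List.Membership.Propositional.Properties using (∈-++⁺ˡ; ∈-++⁺ʳ; ∈-map⁺; ∈-map⁻; ∈-filter⁺; ∈-filter⁻)
open import Data.List.Relation.Unary.All using (lookup)
open import Data.List.Relation.Unary.Any using (here)
open import Data.List.Relation.Unary.Linked using (Linked)
open import Data.List.Relation.Unary.Unique.Propositional using (Unique)
open import Data.Nat.Base using (ℕ; zero; suc; _≤_; NonZero; z≤n)
open import Data.Nat.Properties using (_≤?_)
open import Data.Product.Base using (∃; _×_; _,_; proj₂)
open import Data.Sum.Base using (inj₁; inj₂)
open import Data.Vec.Base using ([]; _∷_; tabulate; here; there)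
open import Function.Base using (id)
open import Level using (0ℓ)
open import Relation.Binary.Construct.Closure.ReflexiveTransitive using (Star)
open import Relation.Binary.Core using (Rel)
open import Relation.Binary.Definitions using (Symmetric; Decidable)
open import Relation.Binary.PropositionalEquality using (_≡_; refl; sym; trans; cong)
open import Relation.Nullary using (¬_; Dec; does)

-- Finite simple undirected graphs of order n, with vertices labelled by Fin n.
record Graph (n : ℕ) : Set₁ where
  infix 4 _~_ _~?_
  field
    _~_   : Rel (Fin n) 0ℓ
    _~?_  : Decidable _~_
    ~-sym : Symmetric _~_
    ~-irr : ∀ {v} → ¬ (v ~ v)

module _ {n : ℕ} (G : Graph n) where
  open Graph G

  neighbours : Fin n → Subset n
  neighbours v = tabulate (λ u → does (v ~? u))

  degree : Fin n → ℕ
  degree v = ∣ neighbours v ∣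

  MaxDegree≤ : ℕ → Set
  MaxDegree≤ k = ∀ v → degree v ≤ k

  maxDegree≤? : ∀ k → Dec (MaxDegree≤ k)
  maxDegree≤? k = all? (λ v → degree v ≤? k)

  Connected : Set
  Connected = ∀ u v → Star _~_ u v

  -- The cycle v , v₁ , … , vₖ , v on k + 1 ≥ 3 distinct vertices.
  record IsCycle (v : Fin n) (vs : List (Fin n)) : Set where
    field
      long     : 2 ≤ length vs
      distinct : Unique (v ∷ vs)
      closed   : Linked _~_ (v ∷ vs ∷ʳ v)

  Acyclic : Set
  Acyclic = ∀ v vs → ¬ IsCycle v vs

  -- Trees have at least one vertex.
  record IsTree : Set where
    field
      nonEmpty  : NonZero n
      connected : Connected
      acyclic   : Acyclic

  record IsSubcubicTree : Set where
    field
      isTree   : IsTree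
      subcubic : MaxDegree≤ 3

-- The increasing enumeration of the elements of F.
embed : ∀ {n} (F : Subset n) → Fin ∣ F ∣ → Fin n
embed (true  ∷ F) zero    = zero
embed (true  ∷ F) (suc i) = suc (embed F i)
embed (false ∷ F) i       = suc (embed F i)

embed-∈ : ∀ {n} (F : Subset n) i → embed F i ∈ F
embed-∈ (true  ∷ F) zero    = here
embed-∈ (true  ∷ F) (suc i) = there (embed-∈ F i)
embed-∈ (false ∷ F) i       = there (embed-∈ F i)

embed-injective : ∀ {n} (F : Subset n) {i j} → embed F i ≡ embed F j → i ≡ j
embed-injective (true  ∷ F) {zero}  {zero}  _ = refl
embed-injective (true  ∷ F) {suc i} {suc j} e = cong suc (embed-injective F (suc-injective e))
embed-injective (false ∷ F) e = embed-injective F (suc-injective e)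

embed-surjective : ∀ {n} (F : Subset n) {v} → v ∈ F → ∃ λ i → embed F i ≡ v
embed-surjective (true  ∷ F) here      = zero , refl
embed-surjective (true  ∷ F) (there p) with i , e ← embed-surjective F p = suc i , cong suc e
embed-surjective (false ∷ F) (there p) with i , e ← embed-surjective F p = i , cong suc e

-- The induced subgraph G[F], with its vertices relabelled by Fin ∣ F ∣.
infix 30 _[_]
_[_] : ∀ {n} → Graph n → (F : Subset n) → Graph ∣ F ∣
G [ F ] = record
  { _~_   = λ i j → embed F i ~ embed F j
  ; _~?_  = λ i j → embed F i ~? embed F j
  ; ~-sym = ~-sym
  ; ~-irr = ~-irr
  }
  where open Graph G

subsets : ∀ n → List (Subset n)
subsets zero    = [] ∷ []
subsets (suc n) = map (inside ∷_) (subsets n) ++ map (outside ∷_) (subsets n)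

∈-subsets : ∀ {n} (F : Subset n) → F ∈ˡ subsets n
∈-subsets []          = here refl
∈-subsets (true  ∷ F) = ∈-++⁺ˡ (∈-map⁺ (inside ∷_) (∈-subsets F))
∈-subsets (false ∷ F) = ∈-++⁺ʳ (map (inside ∷_) (subsets _)) (∈-map⁺ (outside ∷_) (∈-subsets F))

module _ {n : ℕ} (G : Graph n) where

  IsDissociationSet : Subset n → Set
  IsDissociationSet F = MaxDegree≤ (G [ F ]) 1

  isDissociationSet? : ∀ F → Dec (IsDissociationSet F)
  isDissociationSet? F = maxDegree≤? (G [ F ]) 1

  -- The default value 0 is harmless, since ∅ is a dissociation set.
  ψ : ℕ
  ψ = max 0 (map ∣_∣ (filter isDissociationSet? (subsets n)))

  ψ-upper : ∀ F → IsDissociationSet F → ∣ F ∣ ≤ ψ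
  ψ-upper F d = lookup (xs≤max 0 _) (∈-map⁺ ∣_∣ (∈-filter⁺ isDissociationSet? (∈-subsets F) d))

  ψ-attained : ∃ λ F → IsDissociationSet F × ∣ F ∣ ≡ ψ
  ψ-attained with argmax-sel id 0 (map ∣_∣ (filter isDissociationSet? (subsets n)))
  ... | inj₁ ψ≡0 = ⊥ , ⊥-dissociation , trans (∣⊥∣≡0 n) (sym ψ≡0)
    where
    noFin : ∀ {m} {A : Set} → m ≡ 0 → Fin m → A
    noFin refl ()
    ⊥-dissociation : IsDissociationSet ⊥
    ⊥-dissociation v = noFin (∣⊥∣≡0 n) v
  ... | inj₂ ψ∈ with F , F∈ , e ← ∈-map⁻ ∣_∣ ψ∈ =
    F , proj₂ (∈-filter⁻ isDissociationSet? {xs = subsets n} F∈) , sym e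

{-# OPTIONS --safe #-}

-- Upper bound.  A connected graph has at least n − 1 edges.  If F is a
-- dissociation set with k elements, then at most k / 2 edges lie inside F and,
-- all degrees being at most 3, at most 3 (n − k) edges meet the complement of F;
-- so 2 (n − 1) ≤ k + 6 (n − k).
--
-- Lower bound.  Repeatedly remove a vertex v with at most one remaining
-- neighbour p, keeping for every remaining vertex the number c of kept vertices
-- that hang below it and are not yet charged.  If c v ≥ 2, then v is discarded
-- and charged to itself and two vertices below it; otherwise v is kept and c p
-- grows by c v + 1.  So at most one vertex in three is discarded.
module Submission where

open import Defs
open import Data.Bool.Base using (Bool; true; false; if_then_else_)
open import Data.Fin.Base using (Fin; zero; suc)
open import Data.Fin.Properties using (_≟_; ¬∀⟶∃¬)
open import Data.Fin.Subset using (Subset; ∣_∣; ∁) renaming (_∈_ to _∈ₛ_)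
open import Data.Fin.Subset.Properties using (x∈∁p⇒x∉p; x∉p⇒x∈∁p) renaming (_∈?_ to _∈ₛ?_)
open import Data.Integer.Base using (+_; +≤+) renaming (_≤_ to _≤ᶻ_)
open import Data.Integer.Properties using (pos-*)
open import Data.Empty using (⊥)
open import Data.List.Base using (List; []; _∷_; _++_; map; length; tabulate; allFin) renaming (_∷ʳ_ to _∷ʳᴸ_)
open import Data.List.Membership.DecPropositional using () renaming (_∈?_ to member?)
open import Data.List.Membership.Propositional using (_∈_; _∉_; find; lose)
open import Data.List.Membership.Propositional.Properties using (∈-∃++; ∈-allFin; ∈-tabulate⁺; ∈-tabulate⁻; ∈-++⁺ˡ; ∈-++⁺ʳ)
open import Data.List.Membership.Propositional.Properties.WithK using (unique∧set⇒bag)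
open import Data.List.Properties using (length-tabulate; map-tabulate; map-++; ++-assoc; length-++)
open import Data.List.Relation.Binary.BagAndSetEquality using (∼bag⇒↭)
open import Data.List.Relation.Binary.Permutation.Propositional using (_↭_; ↭-refl; ↭-sym; ↭-trans; ↭-prep; ↭⇒↭ₛ)
open import Data.List.Relation.Binary.Permutation.Propositional.Properties using (shift; ↭-length; ∈-resp-↭) renaming (map⁺ to map-↭)
open import Data.List.Relation.Binary.Permutation.Setoid.Properties using (Unique-resp-↭)
open import Data.List.Relation.Binary.Sublist.Propositional using (_⊆_; []; _∷_; _∷ʳ_; ⊆-refl)
open import Data.List.Relation.Binary.Sublist.Propositional.Properties using (All-resp-⊆; ++⁺ʳ)
open import Data.List.Relation.Unary.All using ([]; _∷_) renaming (lookup to All-lookup)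
open import Data.List.Relation.Unary.All.Properties using (¬Any⇒All¬)
open import Data.List.Relation.Unary.AllPairs using ([]; _∷_)
open import Data.List.Relation.Unary.Any using (here; there; any?)
open import Data.List.Relation.Unary.Linked using (Linked; []; [-]; _∷_)
open import Data.List.Relation.Unary.Unique.Propositional using (Unique)
open import Data.List.Relation.Unary.Unique.Propositional.Properties using (allFin⁺; Unique[x∷xs]⇒x∉xs) renaming (++⁺ to Unique-++⁺; tabulate⁺ to Unique-tabulate⁺)
open import Data.Nat.Base using (ℕ; zero; suc; _+_; _*_; _<_; z≤n; s≤s; NonZero; pred) renaming (_≤_ to _≤ⁿ_)
open import Data.Nat.ListAction using (sum)
open import Data.Nat.ListAction.Properties using (sum-++; sum-↭)
open import Data.Nat.Properties using (≤-refl; ≤-pred; *-identityˡ; *-suc; *-distribʳ-+; ≤-trans; ≤-reflexive; ≰⇒>; <⇒≱; m≤m+n; m≤n+m; +-suc; +-comm; +-assoc; +-mono-≤; +-monoˡ-≤; +-monoʳ-≤; *-monoˡ-≤; *-monoʳ-≤; +-cancelʳ-≤; +-identityʳ; *-identityʳ; *-comm; m≤m*n; module ≤-Reasoning) renaming (_≤?_ to _≤ⁿ?_)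
open import Data.Nat.Tactic.RingSolver using (solve-∀)
open import Data.Product.Base using (Σ-syntax; ∃; _×_; _,_)
open import Data.Rational.Unnormalised.Base using (_/_; _≤_; _≃_; *≤*; *≡*)
open import Data.Vec.Base using () renaming (tabulate to tabulateᵛ)
open import Data.Vec.Properties using (lookup⇒[]=; []=⇒lookup; lookup∘tabulate)
open import Function.Base using (_∘_; id)
open import Function.Bundles using (mk⇔)
open import Relation.Binary.Construct.Closure.ReflexiveTransitive using (Star; ε; _◅_)
open import Relation.Binary.PropositionalEquality using (_≡_; _≢_; refl; sym; trans; cong; cong₂; subst; subst₂; setoid)
open import Relation.Nullary using (Dec; yes; no; does; contradiction; ¬?; _×-dec_)
open import Relation.Nullary.Decidable using (dec-true; toWitness)

private
  variable
    n : ℕ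
    A B : Set
    xs ys : List A

∑ : List A → (A → ℕ) → ℕ
∑ xs f = sum (map f xs)

∑-bounded : ∀ (xs : List A) {f} k → (∀ {x} → x ∈ xs → f x ≤ⁿ k) → ∑ xs f ≤ⁿ length xs * k
∑-bounded []       k f≤k = z≤n
∑-bounded (x ∷ xs) k f≤k = +-mono-≤ (f≤k (here refl)) (∑-bounded xs k (f≤k ∘ there))

∑-⊆ : (f : A → ℕ) → xs ⊆ ys → ∑ xs f ≤ⁿ ∑ ys f
∑-⊆ f []         = z≤n
∑-⊆ f (y ∷ʳ τ)   = ≤-trans (∑-⊆ f τ) (m≤n+m _ (f y))
∑-⊆ f (refl ∷ τ) = +-monoʳ-≤ (f _) (∑-⊆ f τ)

∑-↭ : (f : A → ℕ) → xs ↭ ys → ∑ xs f ≡ ∑ ys f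
∑-↭ f p = sum-↭ (map-↭ f p)

∑-++ : ∀ (xs ys : List A) f → ∑ (xs ++ ys) f ≡ ∑ xs f + ∑ ys f
∑-++ xs ys f = trans (cong sum (map-++ f xs ys)) (sum-++ (map f xs) (map f ys))

∑-cong : ∀ (xs : List A) {f g : A → ℕ} → (∀ x → f x ≡ g x) → ∑ xs f ≡ ∑ xs g
∑-cong []       f≗g = refl
∑-cong (x ∷ xs) f≗g = cong₂ _+_ (f≗g x) (∑-cong xs f≗g)

∑-distrib-+ : ∀ (xs : List A) f g → ∑ xs (λ x → f x + g x) ≡ ∑ xs f + ∑ xs g
∑-distrib-+ []       f g = refl
∑-distrib-+ (x ∷ xs) f g rewrite ∑-distrib-+ xs f g = interchange (f x) (g x) (∑ xs f) (∑ xs g)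
  where
  interchange : ∀ a b c d → (a + b) + (c + d) ≡ (a + c) + (b + d)
  interchange = solve-∀

∑-distrib-* : ∀ (xs : List A) f k → ∑ xs (λ x → f x * k) ≡ ∑ xs f * k
∑-distrib-* []       f k = refl
∑-distrib-* (x ∷ xs) f k rewrite ∑-distrib-* xs f k = sym (*-distribʳ-+ k (f x) (∑ xs f))

∑-zero : ∀ (xs : List A) → ∑ xs (λ _ → 0) ≡ 0
∑-zero []       = refl
∑-zero (x ∷ xs) = ∑-zero xs

∑-swap : ∀ (xs : List A) (ys : List B) (f : A → B → ℕ) →
         ∑ xs (λ x → ∑ ys (f x)) ≡ ∑ ys (λ y → ∑ xs (λ x → f x y))
∑-swap []       ys f = sym (∑-zero ys)
∑-swap (x ∷ xs) ys f =
  trans (cong (λ s → ∑ ys (f x) + s) (∑-swap xs ys f)) (sym (∑-distrib-+ ys (f x) _))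

∑-positive : ∀ (xs : List A) {f} → 1 ≤ⁿ ∑ xs f → ∃ λ x → x ∈ xs × 1 ≤ⁿ f x
∑-positive (x ∷ xs) {f} 1≤∑ with f x in eq
... | suc _ = x , here refl , ≤-trans (s≤s z≤n) (≤-reflexive (sym eq))
... | zero with y , y∈xs , 1≤fy ← ∑-positive xs 1≤∑ = y , there y∈xs , 1≤fy

∑-∈ : ∀ {x : A} (f : A → ℕ) → x ∈ xs → f x ≤ⁿ ∑ xs f
∑-∈ f (here refl)      = m≤m+n _ _
∑-∈ f (there {x} x∈xs) = ≤-trans (∑-∈ f x∈xs) (m≤n+m _ (f x))

-- Duplicate-free lists

Unique-resp-⊆ : xs ⊆ ys → Unique ys → Unique xs
Unique-resp-⊆ []         []        = []
Unique-resp-⊆ (_ ∷ʳ τ)   (_ ∷ u)   = Unique-resp-⊆ τ u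
Unique-resp-⊆ (refl ∷ τ) (y∉ ∷ u)  = All-resp-⊆ τ y∉ ∷ Unique-resp-⊆ τ u

Unique-↭ : xs ↭ ys → Unique xs → Unique ys
Unique-↭ p = Unique-resp-↭ (setoid _) (↭⇒↭ₛ p)

pull : ∀ {x : A} → x ∈ xs → ∃ λ ys → xs ↭ x ∷ ys
pull x∈xs with as , bs , refl ← ∈-∃++ x∈xs = as ++ bs , shift _ as bs

Unique⇒length≤ : Unique xs → (∀ {x} → x ∈ xs → x ∈ ys) → length xs ≤ⁿ length ys
Unique⇒length≤ []          _     = z≤n
Unique⇒length≤ {xs = x ∷ xs} u@(_ ∷ u′) xs⊆ys with zs , p ← pull (xs⊆ys (here refl)) =
  ≤-trans (s≤s (Unique⇒length≤ u′ xs⊆zs)) (≤-reflexive (sym (↭-length p)))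
  where
  xs⊆zs : ∀ {y} → y ∈ xs → y ∈ zs
  xs⊆zs y∈xs with ∈-resp-↭ p (xs⊆ys (there y∈xs))
  ... | here refl = contradiction y∈xs (Unique[x∷xs]⇒x∉xs u)
  ... | there y∈zs = y∈zs

Unique⇒length≤n : {xs : List (Fin n)} → Unique xs → length xs ≤ⁿ n
Unique⇒length≤n {n} u =
  ≤-trans (Unique⇒length≤ u (λ _ → ∈-allFin _)) (≤-reflexive (length-tabulate {n = n} id))

Unique⇒↭ : Unique xs → Unique ys → (∀ {x} → x ∈ xs → x ∈ ys) → (∀ {x} → x ∈ ys → x ∈ xs) → xs ↭ ys
Unique⇒↭ u v xs⊆ys ys⊆xs = ∼bag⇒↭ (unique∧set⇒bag u v (mk⇔ xs⊆ys ys⊆xs))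

Linked-++⁻ˡ : ∀ {R : A → A → Set} xs {ys} → Linked R (xs ++ ys) → Linked R xs
Linked-++⁻ˡ []           _       = []
Linked-++⁻ˡ (x ∷ [])     _       = [-]
Linked-++⁻ˡ (x ∷ y ∷ xs) (r ∷ l) = r ∷ Linked-++⁻ˡ (y ∷ xs) l

infix 4 _∈?_
_∈?_ : (v : Fin n) (vs : List (Fin n)) → Dec (v ∈ vs)
_∈?_ = member? _≟_

-- Subsets as lists

elements : Subset n → List (Fin n)
elements F = tabulate (embed F)

∈-elements⁺ : (F : Subset n) {v : Fin n} → v ∈ₛ F → v ∈ elements F
∈-elements⁺ F v∈F with i , refl ← embed-surjective F v∈F = ∈-tabulate⁺ i

∈-elements⁻ : (F : Subset n) {v : Fin n} → v ∈ elements F → v ∈ₛ F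
∈-elements⁻ F v∈ with i , refl ← ∈-tabulate⁻ v∈ = embed-∈ F i

Unique-elements : (F : Subset n) → Unique (elements F)
Unique-elements F = Unique-tabulate⁺ (embed-injective F)

length-elements : (F : Subset n) → length (elements F) ≡ ∣ F ∣
length-elements F = length-tabulate (embed F)

elements-++-∁ : (F : Subset n) → allFin n ↭ elements F ++ elements (∁ F)
elements-++-∁ {n} F = Unique⇒↭ (allFin⁺ n)
  (Unique-++⁺ (Unique-elements F) (Unique-elements (∁ F))
    (λ (p , q) → x∈∁p⇒x∉p (∈-elements⁻ (∁ F) q) (∈-elements⁻ F p)))
  split (λ _ → ∈-allFin _)
  where
  split : ∀ {v} → v ∈ allFin n → v ∈ elements F ++ elements (∁ F)
  split {v} _ with v ∈ₛ? F
  ... | yes v∈F = ∈-++⁺ˡ (∈-elements⁺ F v∈F)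
  ... | no  v∉F = ∈-++⁺ʳ (elements F) (∈-elements⁺ (∁ F) (x∉p⇒x∈∁p v∉F))

fromList : List (Fin n) → Subset n
fromList vs = tabulateᵛ (λ v → does (v ∈? vs))

∈-fromList⁺ : ∀ (vs : List (Fin n)) {v} → v ∈ vs → v ∈ₛ fromList vs
∈-fromList⁺ vs {v} v∈vs =
  lookup⇒[]= v _ (trans (lookup∘tabulate _ v) (dec-true (v ∈? vs) v∈vs))

∈-fromList⁻ : ∀ (vs : List (Fin n)) {v} → v ∈ₛ fromList vs → v ∈ vs
∈-fromList⁻ vs {v} v∈ with v ∈? vs | trans (sym (lookup∘tabulate _ v)) ([]=⇒lookup v∈)
... | yes v∈vs | _  = v∈vs
... | no  _    | ()

elements-fromList : {vs : List (Fin n)} → Unique vs → elements (fromList vs) ↭ vs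
elements-fromList {vs = vs} u = Unique⇒↭ (Unique-elements (fromList vs)) u
  (∈-fromList⁻ vs ∘ ∈-elements⁻ (fromList vs)) (∈-elements⁺ (fromList vs) ∘ ∈-fromList⁺ vs)

indicator : Bool → ℕ
indicator b = if b then 1 else 0

∣tabulate∣ : (f : Fin n → Bool) → ∣ tabulateᵛ f ∣ ≡ sum (tabulate (indicator ∘ f))
∣tabulate∣ {zero}  f = refl
∣tabulate∣ {suc n} f with f zero
... | true  = cong suc (∣tabulate∣ (f ∘ suc))
... | false = ∣tabulate∣ (f ∘ suc)

module _ (G : Graph n) where
  open Graph G

  adj : Fin n → Fin n → ℕ
  adj u v = indicator (does (u ~? v))

  adj-sym : ∀ u v → adj u v ≡ adj v u
  adj-sym u v with u ~? v | v ~? u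
  ... | yes _ | yes _ = refl
  ... | yes p | no ¬p = contradiction (~-sym p) ¬p
  ... | no ¬p | yes p = contradiction (~-sym p) ¬p
  ... | no _  | no _  = refl

  adj-irr : ∀ v → adj v v ≡ 0
  adj-irr v with v ~? v
  ... | yes p = contradiction p ~-irr
  ... | no _  = refl

  ~⇒adj : ∀ {u v} → u ~ v → adj u v ≡ 1
  ~⇒adj {u} {v} p = cong indicator (dec-true (u ~? v) p)

  degree-∑ : ∀ v → degree G v ≡ ∑ (allFin n) (adj v)
  degree-∑ v = trans (∣tabulate∣ (λ u → does (v ~? u))) (cong sum (sym (map-tabulate id (adj v))))

  degree-[]-∑ : ∀ F i → degree (G [ F ]) i ≡ ∑ (elements F) (adj (embed F i))
  degree-[]-∑ F i = trans (∣tabulate∣ (λ j → does (embed F i ~? embed F j)))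
    (cong sum (sym (map-tabulate (embed F) (adj (embed F i)))))

  -- Twice the number of edges when xs = ys.
  edges : List (Fin n) → List (Fin n) → ℕ
  edges xs ys = ∑ xs (λ x → ∑ ys (adj x))

  edges-sym : ∀ xs ys → edges xs ys ≡ edges ys xs
  edges-sym xs ys = trans (∑-swap xs ys adj) (∑-cong ys (λ y → ∑-cong xs (λ x → adj-sym x y)))

  edges-++ʳ : ∀ xs ys zs → edges xs (ys ++ zs) ≡ edges xs ys + edges xs zs
  edges-++ʳ xs ys zs = trans (∑-cong xs (λ x → ∑-++ ys zs (adj x))) (∑-distrib-+ xs _ _)

  edges-↭ : ∀ {xs ys} → xs ↭ ys → edges xs xs ≡ edges ys ys
  edges-↭ {xs} p = trans (∑-cong xs (λ x → ∑-↭ (adj x) p)) (∑-↭ _ p)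

  edges-∷ : ∀ v vs → edges (v ∷ vs) (v ∷ vs) ≡ 2 * ∑ vs (adj v) + edges vs vs
  edges-∷ v vs
    rewrite ∑-distrib-+ vs (λ x → adj x v) (λ x → ∑ vs (adj x))
          | ∑-cong vs (λ x → adj-sym x v)
          | adj-irr v
    = regroup (∑ vs (adj v)) (edges vs vs)
    where
    regroup : ∀ a b → a + (a + b) ≡ 2 * a + b
    regroup = solve-∀

  data Growing : List (Fin n) → Set where
    [-] : ∀ {v} → Growing (v ∷ [])
    _∷_ : ∀ {v vs} → 1 ≤ⁿ ∑ vs (adj v) → Growing vs → Growing (v ∷ vs)

  edges-growing : ∀ {vs} → Growing vs → 2 * length vs ≤ⁿ 2 + edges vs vs
  edges-growing [-] = m≤m+n 2 _
  edges-growing {v ∷ vs} (1≤ ∷ g) = begin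
    2 * suc (length vs)                     ≡⟨ *-suc 2 (length vs) ⟩
    2 + 2 * length vs                       ≤⟨ +-mono-≤ (*-monoʳ-≤ 2 1≤) (edges-growing g) ⟩
    2 * ∑ vs (adj v) + (2 + edges vs vs)    ≡⟨ regroup (∑ vs (adj v)) (edges vs vs) ⟩
    2 + (2 * ∑ vs (adj v) + edges vs vs)    ≡⟨ cong (λ e → 2 + e) (edges-∷ v vs) ⟨
    2 + edges (v ∷ vs) (v ∷ vs)             ∎
    where
    open ≤-Reasoning
    regroup : ∀ a b → 2 * a + (2 + b) ≡ 2 + (2 * a + b)
    regroup = solve-∀

  crossing : ∀ {vs u w} → Star _~_ u w → u ∉ vs → w ∈ vs → ∃ λ x → x ∉ vs × 1 ≤ⁿ ∑ vs (adj x)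
  crossing ε u∉ w∈ = contradiction w∈ u∉
  crossing {vs} {u} (_◅_ {j = y} u~y path) u∉ w∈ with y ∈? vs
  ... | yes y∈ = u , u∉ , ≤-trans (≤-reflexive (sym (~⇒adj u~y))) (∑-∈ (adj u) y∈)
  ... | no  y∉ = crossing path y∉ w∈

  missing : ∀ {vs} → length vs < n → ∃ λ v → v ∉ vs
  missing {vs} l<n = ¬∀⟶∃¬ n (_∈ vs) (_∈? vs) λ all∈ →
    contradiction (≤-trans (≤-reflexive (sym (length-tabulate {n = n} id)))
                           (Unique⇒length≤ (allFin⁺ n) (λ {v} _ → all∈ v)))
                  (<⇒≱ l<n)

  growing : Connected G → Fin n → ∀ k → suc k ≤ⁿ n →
            ∃ λ vs → Growing vs × Unique vs × length vs ≡ suc k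
  growing conn r zero    _ = r ∷ [] , [-] , [] ∷ [] , refl
  growing conn r (suc k) k<n with growing conn r k (≤-trans (m≤n+m _ 1) k<n)
  ... | vs@(w ∷ _) , g , u , l
    with x , x∉ ← missing (subst (_< n) (sym l) k<n)
    with y , y∉ , 1≤ ← crossing (conn x w) x∉ (here refl)
    = y ∷ vs , 1≤ ∷ g , ¬Any⇒All¬ vs y∉ ∷ u , cong suc l

  connected⇒edges≥ : Connected G → 2 * n ≤ⁿ 2 + edges (allFin n) (allFin n)
  connected⇒edges≥ conn = go refl
    where
    go : ∀ {m} → n ≡ m → 2 * n ≤ⁿ 2 + edges (allFin n) (allFin n)
    go {zero}  refl = z≤n
    go {suc k} refl with vs , g , u , l ← growing conn zero k ≤-refl =
      subst (λ e → 2 * n ≤ⁿ 2 + e) (edges-↭ vs↭) (subst (λ m → 2 * m ≤ⁿ 2 + edges vs vs) l (edges-growing g))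
      where
      full : ∀ {v} → v ∈ allFin n → v ∈ vs
      full {v} _ with v ∈? vs
      ... | yes v∈ = v∈
      ... | no  v∉ = contradiction (Unique⇒length≤n (¬Any⇒All¬ vs v∉ ∷ u)) (<⇒≱ (s≤s (≤-reflexive (sym l))))
      vs↭ : vs ↭ allFin n
      vs↭ = Unique⇒↭ u (allFin⁺ n) (λ _ → ∈-allFin _) full

  dissociation-upper : Connected G → MaxDegree≤ G 3 → ∀ F → IsDissociationSet G F →
                       5 * ∣ F ∣ ≤ⁿ 4 * n + 2
  dissociation-upper conn cubic F diss = +-cancelʳ-≤ (2 * n) _ _ (begin
    5 * k + 2 * n                                ≤⟨ +-monoʳ-≤ (5 * k) (connected⇒edges≥ conn) ⟩
    5 * k + (2 + edges V V)                      ≤⟨ +-monoʳ-≤ (5 * k) (+-monoʳ-≤ 2 edges≤) ⟩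
    5 * k + (2 + (k * 1 + (c * 3 + c * 3)))      ≡⟨ regroup k c ⟩
    4 * (k + c) + 2 + 2 * (k + c)                ≡⟨ cong (λ m → 4 * m + 2 + 2 * m) k+c≡n ⟩
    4 * n + 2 + 2 * n                            ∎)
    where
    open ≤-Reasoning
    V = allFin n
    K = elements F
    C = elements (∁ F)
    k = ∣ F ∣
    c = ∣ ∁ F ∣
    regroup : ∀ k c → 5 * k + (2 + (k * 1 + (c * 3 + c * 3))) ≡ 4 * (k + c) + 2 + 2 * (k + c)
    regroup = solve-∀
    p : V ↭ K ++ C
    p = elements-++-∁ F
    k+c≡n : k + c ≡ n
    k+c≡n = sym (begin-equality
      n                    ≡⟨ length-tabulate {n = n} id ⟨
      length V             ≡⟨ ↭-length p ⟩
      length (K ++ C)      ≡⟨ length-++ K ⟩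
      length K + length C  ≡⟨ cong₂ _+_ (length-elements F) (length-elements (∁ F)) ⟩
      k + c                ∎)
    inner : edges K K ≤ⁿ k * 1
    inner = subst (λ m → edges K K ≤ⁿ m * 1) (length-elements F) (∑-bounded K 1 bound)
      where
      bound : ∀ {x} → x ∈ K → ∑ K (adj x) ≤ⁿ 1
      bound x∈ with i , refl ← ∈-tabulate⁻ x∈ = subst (_≤ⁿ 1) (degree-[]-∑ F i) (diss i)
    outer : edges C V ≤ⁿ c * 3
    outer = subst (λ m → edges C V ≤ⁿ m * 3) (length-elements (∁ F))
      (∑-bounded C 3 (λ {x} _ → subst (_≤ⁿ 3) (degree-∑ x) (cubic x)))
    edges-V : ∀ xs → edges xs V ≡ edges xs K + edges xs C
    edges-V xs = trans (∑-cong xs (λ x → ∑-↭ (adj x) p)) (edges-++ʳ xs K C)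
    edges≤ : edges V V ≤ⁿ k * 1 + (c * 3 + c * 3)
    edges≤ = begin
      edges V V                                  ≡⟨ edges-V V ⟩
      edges V K + edges V C                      ≡⟨ cong₂ _+_ (edges-sym V K) (edges-sym V C) ⟩
      edges K V + edges C V                      ≡⟨ cong (_+ edges C V) (edges-V K) ⟩
      edges K K + edges K C + edges C V          ≡⟨ +-assoc (edges K K) _ _ ⟩
      edges K K + (edges K C + edges C V)        ≡⟨ cong (λ e → edges K K + (e + edges C V)) (edges-sym K C) ⟩
      edges K K + (edges C K + edges C V)        ≤⟨ +-monoʳ-≤ (edges K K) (+-monoˡ-≤ _ (m≤m+n (edges C K) (edges C C))) ⟩
      edges K K + (edges C K + edges C C + edges C V)
                                                 ≡⟨ cong (λ e → edges K K + (e + edges C V)) (edges-V C) ⟨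
      edges K K + (edges C V + edges C V)        ≤⟨ +-mono-≤ inner (+-mono-≤ outer outer) ⟩
      k * 1 + (c * 3 + c * 3)                    ∎

  data Eliminating : List (Fin n) → Set where
    []  : Eliminating []
    _∷_ : ∀ {v vs} → ∑ vs (adj v) ≤ⁿ 1 → Eliminating vs → Eliminating (v ∷ vs)

  ∑adj≤1 : ∀ {vs} v p → Unique vs → (∀ {u} → u ∈ vs → v ~ u → u ≡ p) → ∑ vs (adj v) ≤ⁿ 1
  ∑adj≤1 v p [] only = z≤n
  ∑adj≤1 {u ∷ us} v p (u∉ ∷ uniq) only with v ~? u
  ... | no _ = ∑adj≤1 v p uniq (only ∘ there)
  ... | yes v~u = s≤s (≤-trans (∑-bounded us 0 none) (≤-reflexive (*-comm (length us) 0)))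
    where
    none : ∀ {w} → w ∈ us → adj v w ≤ⁿ 0
    none {w} w∈ with v ~? w
    ... | no _ = z≤n
    ... | yes v~w = contradiction (trans (only (here refl) v~u) (sym (only (there w∈) v~w))) (All-lookup u∉ w∈)

  -- For a path with one vertex, x is a harmless default since x is not its own neighbour.
  second : Fin n → List (Fin n) → Fin n
  second x []      = x
  second x (y ∷ _) = y

  chord⇒cycle : ∀ {x xs y} → Unique (x ∷ xs) → Linked _~_ (x ∷ xs) →
                x ~ y → y ≢ second x xs → y ∈ xs → ∃ λ vs → IsCycle G y vs
  chord⇒cycle u l x~y y≢ (here refl) = contradiction refl y≢
  chord⇒cycle {x} {h ∷ _} {y} u l x~y y≢ (there y∈) with as , bs , refl ← ∈-∃++ y∈ =
    x ∷ h ∷ as , record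
      { long     = s≤s (s≤s z≤n)
      ; distinct = Unique-resp-⊆ (++⁺ʳ bs ⊆-refl) (Unique-↭ (shift y (x ∷ h ∷ as) bs) u)
      ; closed   = ~-sym x~y ∷ Linked-++⁻ˡ ((x ∷ h ∷ as) ∷ʳᴸ y)
                     (subst (Linked _~_) (sym (++-assoc (x ∷ h ∷ as) (y ∷ []) bs)) l)
      }

  -- Walking along a path that never turns back, one gets stuck at a leaf.
  leaf : Acyclic G → ∀ {S} → Unique S → ∀ k {x xs} → n < k + length (x ∷ xs) → x ∈ S →
         Unique (x ∷ xs) → Linked _~_ (x ∷ xs) → ∃ λ v → v ∈ S × ∑ S (adj v) ≤ⁿ 1
  leaf acyc uS zero n< x∈ u l = contradiction (Unique⇒length≤n u) (<⇒≱ n<)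
  leaf acyc {S} uS (suc k) {x} {xs} n< x∈ u l
    with any? (λ y → (x ~? y) ×-dec ¬? (y ≟ second x xs)) S
  ... | no none = x , x∈ , ∑adj≤1 x (second x xs) uS only
    where
    only : ∀ {y} → y ∈ S → x ~ y → y ≡ second x xs
    only {y} y∈ x~y with y ≟ second x xs
    ... | yes e = e
    ... | no ne = contradiction (lose y∈ (x~y , ne)) none
  ... | yes some with y , y∈S , x~y , y≢ ← find some with y ∈? (x ∷ xs)
  ... | no y∉ = leaf acyc uS k (subst (n <_) (sym (+-suc k _)) n<) y∈S
                  (¬Any⇒All¬ _ y∉ ∷ u) (~-sym x~y ∷ l)
  ... | yes (here refl) = contradiction x~y ~-irr
  ... | yes (there y∈) with vs , cyc ← chord⇒cycle u l x~y y≢ y∈ = contradiction cyc (acyc y vs)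

  eliminating : Acyclic G → ∀ k S → length S ≡ k → Unique S → ∃ λ vs → Eliminating vs × vs ↭ S
  eliminating acyc zero    []      _ _ = [] , [] , ↭-refl
  eliminating acyc (suc k) S@(s ∷ _) l uS
    with v , v∈ , deg≤1 ← leaf acyc uS n {s} {[]} (≤-reflexive (+-comm 1 n)) (here refl) ([] ∷ []) [-]
    with S′ , p ← pull v∈
    with _ ∷ uS′ ← Unique-↭ p uS
    with vs , e , q ← eliminating acyc k S′ (cong pred (trans (sym (↭-length p)) l)) uS′
    = v ∷ vs , deg ∷ e , ↭-trans (↭-prep v q) (↭-sym p)
    where
    deg : ∑ vs (adj v) ≤ⁿ 1
    deg = begin
      ∑ vs (adj v)       ≡⟨ ∑-↭ (adj v) q ⟩
      ∑ S′ (adj v)       ≤⟨ m≤n+m _ (adj v v) ⟩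
      ∑ (v ∷ S′) (adj v) ≡⟨ ∑-↭ (adj v) p ⟨
      ∑ S (adj v)        ≤⟨ deg≤1 ⟩
      1                  ∎
      where open ≤-Reasoning

  record WeightedDissociation (c : Fin n → ℕ) (vs : List (Fin n)) : Set where
    field
      kept   : List (Fin n)
      kept⊆  : kept ⊆ vs
      sparse : ∀ {w} → w ∈ kept → c w + ∑ kept (adj w) ≤ⁿ 1
      large  : 2 * length vs ≤ⁿ 3 * length kept + ∑ vs c

  weightedDissociation : ∀ {vs} → Eliminating vs → ∀ c → WeightedDissociation c vs
  weightedDissociation [] c = record { kept = [] ; kept⊆ = [] ; sparse = λ () ; large = z≤n }
  weightedDissociation {v ∷ vs} (deg≤1 ∷ e) c with 2 ≤ⁿ? c v
  ... | yes 2≤cv = record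
    { kept   = kept
    ; kept⊆  = v ∷ʳ kept⊆
    ; sparse = sparse
    ; large  = begin
        2 * suc (length vs)                 ≡⟨ *-suc 2 (length vs) ⟩
        2 + 2 * length vs                   ≤⟨ +-mono-≤ 2≤cv large ⟩
        c v + (3 * length kept + ∑ vs c)    ≡⟨ regroup (c v) (3 * length kept) (∑ vs c) ⟩
        3 * length kept + (c v + ∑ vs c)    ∎
    }
    where
    open WeightedDissociation (weightedDissociation e c)
    open ≤-Reasoning
    regroup : ∀ a b d → a + (b + d) ≡ b + (a + d)
    regroup = solve-∀
  ... | no 2≰cv = record
    { kept   = v ∷ kept
    ; kept⊆  = refl ∷ kept⊆
    ; sparse = sparse′
    ; large  = begin
        2 * suc (length vs)                                   ≡⟨ *-suc 2 (length vs) ⟩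
        2 + 2 * length vs                                     ≤⟨ +-monoʳ-≤ 2 large ⟩
        2 + (3 * length kept + ∑ vs c′)                       ≡⟨ cong (λ s → 2 + (3 * length kept + s)) ∑c′ ⟩
        2 + (3 * length kept + (∑ vs c + ∑ vs (adj v) * suc (c v)))
          ≤⟨ +-monoʳ-≤ 2 (+-monoʳ-≤ (3 * length kept) (+-monoʳ-≤ (∑ vs c) (*-monoˡ-≤ (suc (c v)) deg≤1))) ⟩
        2 + (3 * length kept + (∑ vs c + 1 * suc (c v)))      ≡⟨ regroup (length kept) (∑ vs c) (c v) ⟩
        3 * suc (length kept) + (c v + ∑ vs c)                ∎
    }
    where
    c′ : Fin n → ℕ
    c′ u = c u + adj v u * suc (c v)
    open WeightedDissociation (weightedDissociation e c′)
    open ≤-Reasoning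
    regroup : ∀ l s a → 2 + (3 * l + (s + 1 * suc a)) ≡ 3 * suc l + (a + s)
    regroup = solve-∀
    ∑c′ : ∑ vs c′ ≡ ∑ vs c + ∑ vs (adj v) * suc (c v)
    ∑c′ = trans (∑-distrib-+ vs c _) (cong (λ s → ∑ vs c + s) (∑-distrib-* vs (adj v) (suc (c v))))
    cv≤1 : c v ≤ⁿ 1
    cv≤1 = ≤-pred (≰⇒> 2≰cv)
    ∑kept≤1 : ∑ kept (adj v) ≤ⁿ 1
    ∑kept≤1 = ≤-trans (∑-⊆ (adj v) kept⊆) deg≤1
    -- A kept neighbour w of v forces c v = 0, because c′ w ≥ c v + 1.
    head-sparse : c v + ∑ kept (adj v) ≤ⁿ 1
    head-sparse with 1 ≤ⁿ? ∑ kept (adj v)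
    ... | no ¬1≤ = +-mono-≤ cv≤1 (≤-pred (≰⇒> ¬1≤))
    ... | yes 1≤ with w , w∈ , 1≤adj ← ∑-positive kept 1≤ = +-mono-≤ cv≤0 ∑kept≤1
      where
      cv≤0 : c v ≤ⁿ 0
      cv≤0 = ≤-pred (begin
        suc (c v)                  ≡⟨ *-identityˡ (suc (c v)) ⟨
        1 * suc (c v)              ≤⟨ *-monoˡ-≤ (suc (c v)) 1≤adj ⟩
        adj v w * suc (c v)        ≤⟨ m≤n+m _ (c w) ⟩
        c′ w                       ≤⟨ m≤m+n _ _ ⟩
        c′ w + ∑ kept (adj w)      ≤⟨ sparse w∈ ⟩
        1                          ∎)
    sparse′ : ∀ {w} → w ∈ v ∷ kept → c w + (adj w v + ∑ kept (adj w)) ≤ⁿ 1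
    sparse′ (here refl) rewrite adj-irr v = head-sparse
    sparse′ {w} (there w∈) = begin
      c w + (adj w v + ∑ kept (adj w))          ≡⟨ +-assoc (c w) _ _ ⟨
      c w + adj w v + ∑ kept (adj w)            ≡⟨ cong (λ a → c w + a + ∑ kept (adj w)) (adj-sym w v) ⟩
      c w + adj v w + ∑ kept (adj w)            ≤⟨ +-monoˡ-≤ _ (+-monoʳ-≤ (c w) (m≤m*n (adj v w) (suc (c v)))) ⟩
      c′ w + ∑ kept (adj w)                     ≤⟨ sparse w∈ ⟩
      1                                         ∎

  acyclic⇒dissociation : Acyclic G → ∃ λ F → IsDissociationSet G F × 2 * n ≤ⁿ 3 * ∣ F ∣
  acyclic⇒dissociation acyc
    with vs , e , p ← eliminating acyc _ (allFin n) refl (allFin⁺ n)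
    = F , diss , (begin
      2 * n                              ≡⟨ cong (2 *_) (length-tabulate {n = n} id) ⟨
      2 * length (allFin n)              ≡⟨ cong (2 *_) (↭-length p) ⟨
      2 * length vs                      ≤⟨ large ⟩
      3 * length kept + ∑ vs (λ _ → 0)   ≡⟨ cong (λ s → 3 * length kept + s) (∑-zero vs) ⟩
      3 * length kept + 0                ≡⟨ +-identityʳ _ ⟩
      3 * length kept                    ≡⟨ cong (3 *_) (↭-length q) ⟨
      3 * length (elements F)            ≡⟨ cong (3 *_) (length-elements F) ⟩
      3 * ∣ F ∣                          ∎)
    where
    open ≤-Reasoning
    open WeightedDissociation (weightedDissociation e (λ _ → 0))
    F = fromList kept
    q : elements F ↭ kept
    q = elements-fromList (Unique-resp-⊆ kept⊆ (Unique-↭ (↭-sym p) (allFin⁺ n)))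
    diss : IsDissociationSet G F
    diss i = begin
      degree (G [ F ]) i                   ≡⟨ degree-[]-∑ F i ⟩
      ∑ (elements F) (adj (embed F i))     ≡⟨ ∑-↭ (adj (embed F i)) q ⟩
      ∑ kept (adj (embed F i))             ≤⟨ sparse (∈-fromList⁻ kept (embed-∈ F i)) ⟩
      1                                    ∎

-- Tightness

data StarAdjacent {m} : Fin (suc m) → Fin (suc m) → Set where
  out : ∀ {i} → StarAdjacent zero (suc i)
  inw : ∀ {i} → StarAdjacent (suc i) zero

star : ∀ m → Graph (suc m)
star m = record
  { _~_   = StarAdjacent
  ; _~?_  = dec
  ; ~-sym = λ { out → inw ; inw → out }
  ; ~-irr = λ ()
  }
  where
  dec : ∀ (u v : Fin (suc m)) → Dec (StarAdjacent u v)
  dec zero    zero    = no λ ()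
  dec zero    (suc _) = yes out
  dec (suc _) zero    = yes inw
  dec (suc _) (suc _) = no λ ()

star-connected : ∀ m → Connected (star m)
star-connected m zero    zero    = ε
star-connected m zero    (suc _) = out ◅ ε
star-connected m (suc _) zero    = inw ◅ ε
star-connected m (suc _) (suc _) = inw ◅ out ◅ ε

-- A path on three vertices runs through the centre and cannot be prolonged.
star-acyclic : ∀ m → Acyclic (star m)
star-acyclic m v vs cyc = go vs long distinct closed
  where
  open IsCycle cyc
  go : ∀ vs → 2 ≤ⁿ length vs → Unique (v ∷ vs) → Linked StarAdjacent (v ∷ vs ∷ʳᴸ v) → ⊥
  go (_ ∷ [])        (s≤s ()) _ _
  go (_ ∷ _ ∷ _)     _ ((_ ∷ v≢b ∷ _) ∷ _)       (out ∷ inw ∷ _)       = v≢b refl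
  go (_ ∷ _ ∷ [])    _ _                         (inw ∷ out ∷ () ∷ _)
  go (_ ∷ _ ∷ _ ∷ _) _ (_ ∷ (_ ∷ a≢d ∷ _) ∷ _)   (inw ∷ out ∷ inw ∷ _) = a≢d refl

star-isSubcubicTree : ∀ m → MaxDegree≤ (star m) 3 → IsSubcubicTree (star m)
star-isSubcubicTree m cubic = record
  { isTree   = record { nonEmpty = _ ; connected = star-connected m ; acyclic = star-acyclic m }
  ; subcubic = cubic
  }

theorem2p4 : (∀ (n : ℕ) (T : Graph n) → IsSubcubicTree T →
    (+ (2 * n) / 3 ≤ + ψ T / 1) × (+ ψ T / 1 ≤ + (4 * n + 2) / 5))
    × (Σ[ n ∈ ℕ ] Σ[ T ∈ Graph n ]
    IsSubcubicTree T × + (2 * n) / 3 ≃ + ψ T / 1)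
    × (Σ[ n ∈ ℕ ] Σ[ T ∈ Graph n ]
    IsSubcubicTree T × + ψ T / 1 ≃ + (4 * n + 2) / 5)
theorem2p4 =
  (λ n T subcubicTree → lower n T subcubicTree , upper n T subcubicTree)
  , (3 , star 2 , star-isSubcubicTree 2 (toWitness {a? = maxDegree≤? (star 2) 3} _) , *≡* refl)
  , (2 , star 1 , star-isSubcubicTree 1 (toWitness {a? = maxDegree≤? (star 1) 3} _) , *≡* refl)
  where
  /-mono : ∀ a b p q .{{_ : NonZero p}} .{{_ : NonZero q}} → a * q ≤ⁿ b * p → + a / p ≤ + b / q
  /-mono a b p@(suc _) q@(suc _) aq≤bp =
    *≤* (subst₂ _≤ᶻ_ (pos-* a q) (pos-* b p) (+≤+ aq≤bp))

  lower : ∀ n (T : Graph n) → IsSubcubicTree T → + (2 * n) / 3 ≤ + ψ T / 1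
  lower n T t with F , diss , 2n≤3k ← acyclic⇒dissociation T (IsTree.acyclic (IsSubcubicTree.isTree t)) =
    /-mono (2 * n) (ψ T) 3 1 (begin
      2 * n * 1   ≡⟨ *-identityʳ (2 * n) ⟩
      2 * n       ≤⟨ 2n≤3k ⟩
      3 * ∣ F ∣   ≤⟨ *-monoʳ-≤ 3 (ψ-upper T F diss) ⟩
      3 * ψ T     ≡⟨ *-comm 3 (ψ T) ⟩
      ψ T * 3     ∎)
    where open ≤-Reasoning

  upper : ∀ n (T : Graph n) → IsSubcubicTree T → + ψ T / 1 ≤ + (4 * n + 2) / 5
  upper n T t with F , diss , k≡ψ ← ψ-attained T =
    /-mono (ψ T) (4 * n + 2) 1 5 (begin
      ψ T * 5           ≡⟨ *-comm (ψ T) 5 ⟩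
      5 * ψ T           ≡⟨ cong (5 *_) k≡ψ ⟨
      5 * ∣ F ∣         ≤⟨ dissociation-upper T (IsTree.connected (IsSubcubicTree.isTree t)) (IsSubcubicTree.subcubic t) F diss ⟩
      4 * n + 2         ≡⟨ *-identityʳ (4 * n + 2) ⟨
      (4 * n + 2) * 1   ∎)
    where open ≤-Reasoning
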